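{- The class of graphs without isolated vertices (i.e., the class of models of the first-order sentence $\forall x\exists y\, Exy$) has no query algorithm.
   Context: Graphs are finite, simple, undirected, with non-empty vertex set; classes are closed under isomorphism. A vertex is isolated if it has degree $0$. For graphs $F,G$, $\hom(F,G)$ is the number of homomorphisms from $F$ to $G$. A class $\mathcal C$ has a hom algorithm if there are $k\ge1$, graphs $F_1,\dots,F_k$ and a set $X\subseteq\mathbb N^k$ such that for every graph $G$: $G\in\mathcal C\iff(\hom(F_1,G),\dots,\hom(F_k,G))\in X$. Emb, s-hom and s-emb algorithms are defined analogously using the numbers of injective homomorphisms, of strong homomorphisms ($uv\in E(F)\iff f(u)f(v)\in E(G)$), and of injective strong homomorphisms. A class has a query algorithm if it has an algorithm of one (equivalently, each) of these four types. -}

module Defs where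

open import Data.Nat using (ℕ; zero; suc; NonZero)
open import Data.Bool using (Bool; true; false)
open import Data.Bool.Properties using () renaming (_≟_ to _≟B_)
open import Data.Fin using (Fin; zero; suc; _≟_)
open import Data.Fin.Properties using (all?)
open import Data.Vec using (Vec; []; _∷_; lookup)
open import Data.List using (List; []; _∷_; [_]; map; concatMap; filter; length; allFin)
open import Data.Product using (Σ; ∃; _×_; _,_)
open import Data.Sum using (_⊎_)
open import Relation.Nullary using (Dec; ¬_; yes; no)
open import Relation.Nullary.Decidable using (_→-dec_; _×-dec_)
open import Relation.Binary.PropositionalEquality using (_≡_)
open import Function.Bundles using (_⇔_)

record Graph : Set where
  field
    n       : ℕ
    nonZero : NonZero n
    adj     : Fin n → Fin n → Bool
    sym     : ∀ u v → adj u v ≡ adj v u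
    irrefl  : ∀ u → adj u u ≡ false
open Graph public

Map : Graph → Graph → Set
Map F G = Fin (n F) → Fin (n G)

IsHom : (F G : Graph) → Map F G → Set
IsHom F G f = ∀ u v → adj F u v ≡ true → adj G (f u) (f v) ≡ true

IsStrongHom : (F G : Graph) → Map F G → Set
IsStrongHom F G f = ∀ u v → adj F u v ≡ adj G (f u) (f v)

IsInjective : (F G : Graph) → Map F G → Set
IsInjective F G f = ∀ u v → f u ≡ f v → u ≡ v

isHom? : ∀ F G f → Dec (IsHom F G f)
isHom? F G f = all? λ u → all? λ v → (adj F u v ≟B true) →-dec (adj G (f u) (f v) ≟B true)

isStrongHom? : ∀ F G f → Dec (IsStrongHom F G f)
isStrongHom? F G f = all? λ u → all? λ v → adj F u v ≟B adj G (f u) (f v)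

isInjective? : ∀ F G f → Dec (IsInjective F G f)
isInjective? F G f = all? λ u → all? λ v → (f u ≟ f v) →-dec (u ≟ v)

allVecs : (k m : ℕ) → List (Vec (Fin k) m)
allVecs k zero    = [ [] ]
allVecs k (suc m) = concatMap (λ x → map (x ∷_) (allVecs k m)) (allFin k)

count : (F G : Graph) (P : Map F G → Set) → (∀ f → Dec (P f)) → ℕ
count F G P P? = length (filter (λ v → P? (lookup v)) (allVecs (n G) (n F)))

hom emb shom semb : Graph → Graph → ℕ
hom  F G = count F G (IsHom F G) (isHom? F G)
emb  F G = count F G (λ f → IsHom F G f × IsInjective F G f)
                     (λ f → isHom? F G f ×-dec isInjective? F G f)
shom F G = count F G (IsStrongHom F G) (isStrongHom? F G)
semb F G = count F G (λ f → IsStrongHom F G f × IsInjective F G f)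
                     (λ f → isStrongHom? F G f ×-dec isInjective? F G f)

Class : Set₁
Class = Graph → Set

HasAlgorithm : (Graph → Graph → ℕ) → Class → Set₁
HasAlgorithm cnt C =
  Σ ℕ λ k → Σ (Vec Graph (suc k)) λ Fs → Σ (Vec ℕ (suc k) → Set) λ X →
    ∀ G → C G ⇔ X (Data.Vec.map (λ F → cnt F G) Fs)

HasQueryAlgorithm : Class → Set₁
HasQueryAlgorithm C =
  HasAlgorithm hom C ⊎ HasAlgorithm emb C ⊎ HasAlgorithm shom C ⊎ HasAlgorithm semb C

NoIsolatedVertex : Class
NoIsolatedVertex G = ∀ u → ∃ λ v → adj G u v ≡ true

{-# OPTIONS --safe #-}

-- For a bit ε let G ε consist of a clique on {0, …, N} together with, for every subset T of
-- {0, …, N} of parity ε, one further vertex whose neighbourhood is T.  Then G 1 has no isolated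
-- vertex, whereas the vertex of T = ∅ is isolated in G 0.  A map from fewer than N vertices into
-- G ε misses some clique vertex y > 0.  Replacing every T in its image by T Δ {y}, for the least
-- such y, yields a map into G (1 - ε) with the same pattern of adjacencies and equalities, and
-- doing so twice gives back the original map.  Hence all four kinds of counts agree on G 0 and G 1
-- for every graph with fewer than N vertices.

module Submission where

open import Defs
open import Data.Bool using (Bool; true; false; not; _xor_)
open import Data.Bool.Properties using (not-involutive; xor-annihilates-not; not-distribˡ-xor; not-distribʳ-xor)
open import Data.Fin using (Fin; zero; suc; _≟_)
open import Data.Fin.Properties using (any?; ¬∀⟶∃¬; <⇒notInjective; +↔⊎; *↔×; 2↔Bool)
open import Data.List using ([]; _∷_; map; concatMap; cartesianProductWith; filter; length; allFin; _++_)
open import Data.List.Membership.Propositional using (_∈_)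
open import Data.List.Membership.Propositional.Properties using (∈-allFin; ∈-cartesianProductWith⁺; ∈-filter⁺; ∈-filter⁻; ∈-map⁺; ∈-map⁻)
open import Data.List.Membership.Propositional.Properties.WithK using (unique∧set⇒bag)
open import Data.List.Properties using (length-map)
open import Data.List.Relation.Binary.BagAndSetEquality using (∼bag⇒↭)
open import Data.List.Relation.Binary.Permutation.Propositional.Properties using (↭-length)
open import Data.List.Relation.Unary.All using ([])
open import Data.List.Relation.Unary.AllPairs using ([]; _∷_)
open import Data.List.Relation.Unary.Any using (here)
open import Data.List.Relation.Unary.Unique.Propositional using (Unique)
open import Data.List.Relation.Unary.Unique.Propositional.Properties using (allFin⁺; cartesianProductWith⁺; filter⁺; map⁺)
open import Data.Maybe using (Maybe; just; nothing)
open import Data.Maybe.Properties using (just-injective; ≡-dec)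
open import Data.Nat using (ℕ; zero; suc; _+_; _^_; _<_; _⊔_; s≤s; z≤n)
open import Data.Nat.Properties using (<-≤-trans; m≤m⊔n; m≤n⊔m)
open import Data.Product using (∃; _×_; _,_; proj₁; proj₂; uncurry)
open import Data.Product.Function.NonDependent.Propositional using (_×-↔_)
open import Data.Sum using (_⊎_; inj₁; inj₂)
open import Data.Sum.Function.Propositional using (_⊎-↔_)
open import Data.Vec as Vec using (Vec; []; _∷_; lookup; updateAt; replicate)
open import Data.Vec.Properties as Vecₚ using (lookup-map; lookup∘updateAt′; ∷-injective; lookup-replicate)
open import Data.Vec.Relation.Unary.All as All using (All; []; _∷_)
open import Function using (_∘_; id)
open import Function.Bundles using (_↔_; mk↔ₛ′; mk⇔; Inverse; Equivalence)
open import Function.Properties.Inverse using (↔-refl; ↔-trans)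
open import Relation.Binary.PropositionalEquality as ≡ using (_≡_; _≢_; refl; cong; cong₂; subst; module ≡-Reasoning)
open import Relation.Nullary using (Dec; yes; no; does; ¬_)
open import Relation.Nullary.Decidable using (dec-true; dec-false; _×-dec_)
open import Relation.Unary using (Decidable)

-- Equal counts from an involution.

-- The lists `map φ (filter P? xs)` and `filter Q? xs` are free of repetitions and have the same
-- members, so they are permutations of each other.
length-filter-involution :
  ∀ {A : Set} {P Q : A → Set} (P? : Decidable P) (Q? : Decidable Q) {xs} →
  Unique xs → (∀ x → x ∈ xs) →
  (φ : A → A) → (∀ x → φ (φ x) ≡ x) →
  (∀ x → P x → Q (φ x)) → (∀ x → Q x → P (φ x)) →
  length (filter P? xs) ≡ length (filter Q? xs)
length-filter-involution P? Q? {xs} xs! ∈xs φ φφ P⇒Q Q⇒P =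
  ≡.trans (≡.sym (length-map φ (filter P? xs)))
          (↭-length (∼bag⇒↭ (unique∧set⇒bag (map⁺ φ-injective (filter⁺ P? xs!)) (filter⁺ Q? xs!) (mk⇔ to from))))
  where
  φ-injective : ∀ {x y} → φ x ≡ φ y → x ≡ y
  φ-injective {x} {y} eq = ≡.trans (≡.sym (φφ x)) (≡.trans (cong φ eq) (φφ y))

  to : ∀ {z} → z ∈ map φ (filter P? xs) → z ∈ filter Q? xs
  to z∈ with x , x∈ , refl ← ∈-map⁻ φ z∈ =
    ∈-filter⁺ Q? (∈xs _) (P⇒Q x (proj₂ (∈-filter⁻ P? {xs = xs} x∈)))

  from : ∀ {z} → z ∈ filter Q? xs → z ∈ map φ (filter P? xs)
  from {z} z∈ = subst (_∈ _) (φφ z)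
    (∈-map⁺ φ (∈-filter⁺ P? (∈xs _) (Q⇒P z (proj₂ (∈-filter⁻ Q? {xs = xs} z∈)))))

-- Brings `allVecs` into product form, where uniqueness and completeness follow by induction on the
-- length.
concatMap-map : ∀ {A B C : Set} (f : A → B → C) xs ys →
  concatMap (λ x → map (f x) ys) xs ≡ cartesianProductWith f xs ys
concatMap-map f []       ys = refl
concatMap-map f (x ∷ xs) ys = cong (map (f x) ys ++_) (concatMap-map f xs ys)

allVecs-unique : ∀ k m → Unique (allVecs k m)
allVecs-unique k zero    = [] ∷ []
allVecs-unique k (suc m) = subst Unique (≡.sym (concatMap-map _∷_ (allFin k) (allVecs k m)))
  (cartesianProductWith⁺ _∷_ ∷-injective (allFin⁺ k) (allVecs-unique k m))

allVecs-complete : ∀ k {m} (v : Vec (Fin k) m) → v ∈ allVecs k m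
allVecs-complete k         []      = here refl
allVecs-complete k {suc m} (x ∷ v) = subst (_ ∈_) (≡.sym (concatMap-map _∷_ (allFin k) (allVecs k m)))
  (∈-cartesianProductWith⁺ _∷_ (∈-allFin x) (allVecs-complete k v))

-- Each property behind the four counts passes from `f` to `f′` along these two fields, so one
-- argument serves all four.
record SamePattern {m} (G G′ : Graph) (f : Fin m → Fin (n G)) (f′ : Fin m → Fin (n G′)) : Set where
  field
    adj-≡     : ∀ u v → adj G (f u) (f v) ≡ adj G′ (f′ u) (f′ v)
    reflect-≡ : ∀ u v → f′ u ≡ f′ v → f u ≡ f v
open SamePattern

module _ {F G G′ : Graph} {f : Map F G} {f′ : Map F G′} (s : SamePattern G G′ f f′) where

  isHom-transfer : IsHom F G f → IsHom F G′ f′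
  isHom-transfer h u v e = ≡.trans (≡.sym (adj-≡ s u v)) (h u v e)

  isStrongHom-transfer : IsStrongHom F G f → IsStrongHom F G′ f′
  isStrongHom-transfer h u v = ≡.trans (h u v) (adj-≡ s u v)

  isInjective-transfer : IsInjective F G f → IsInjective F G′ f′
  isInjective-transfer i u v e = i u v (reflect-≡ s u v e)

-- Pigeonhole: if every `y` occurred in `c`, picking an index for each would inject `Fin N` into
-- `Fin m`. The choice of `y` depends on a map only through its colours `c`, which `fresh-twist`
-- exploits.
unused : ∀ {m N} → m < N → (c : Vec (Maybe (Fin N)) m) → ∃ λ y → ¬ (∃ λ i → lookup c i ≡ just y)
unused {m} {N} m<N c = ¬∀⟶∃¬ N _ (λ y → any? λ i → ≡-dec _≟_ (lookup c i) (just y))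
  λ used → <⇒notInjective {f = proj₁ ∘ used} m<N λ {x} {y} eq → just-injective
    (≡.trans (≡.sym (proj₂ (used x))) (≡.trans (cong (lookup c) eq) (proj₂ (used y))))

parity : ∀ {N} → Vec Bool N → Bool
parity []      = false
parity (b ∷ S) = b xor parity S

parity-updateAt-not : ∀ {N} (S : Vec Bool N) y → parity (updateAt S y not) ≡ not (parity S)
parity-updateAt-not (b ∷ S) zero    = ≡.sym (not-distribˡ-xor b (parity S))
parity-updateAt-not (b ∷ S) (suc y) =
  ≡.trans (cong (b xor_) (parity-updateAt-not S y)) (≡.sym (not-distribʳ-xor b (parity S)))

parity-replicate-false : ∀ N → parity (replicate N false) ≡ false
parity-replicate-false zero    = refl
parity-replicate-false (suc N) = parity-replicate-false N

parity-true⇒∃ : ∀ {N} (S : Vec Bool N) → parity S ≡ true → ∃ λ y → lookup S y ≡ true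
parity-true⇒∃ (true  ∷ S) p = zero , refl
parity-true⇒∃ (false ∷ S) p with y , e ← parity-true⇒∃ S p = suc y , e

Fin-2^↔Vec-Bool : ∀ N → Fin (2 ^ N) ↔ Vec Bool N
Fin-2^↔Vec-Bool zero    = mk↔ₛ′ (λ _ → []) (λ _ → zero) (λ { [] → refl }) (λ { zero → refl })
Fin-2^↔Vec-Bool (suc N) = ↔-trans *↔× (↔-trans (2↔Bool ×-↔ Fin-2^↔Vec-Bool N)
  (mk↔ₛ′ (uncurry _∷_) Vec.uncons (λ { (b ∷ S) → refl }) (λ _ → refl)))

-- The two graphs built from a clique and the sets of given parity.

module _ (N : ℕ) where

  -- A set T ⊆ {0, …, N} of parity ε is given by S = T ∖ {0}, so that G false and G true have the
  -- same vertices; whether 0 ∈ T is recovered from ε.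
  Vertex : Set
  Vertex = Fin (suc N) ⊎ Vec Bool N

  vertices : Fin (suc N + 2 ^ N) ↔ Vertex
  vertices = ↔-trans +↔⊎ (↔-refl ⊎-↔ Fin-2^↔Vec-Bool N)

  open Inverse vertices using () renaming
    (to to decode; from to encode; strictlyInverseˡ to decode-encode; strictlyInverseʳ to encode-decode)

  -- The bit at `zero` is the one that gives the full set parity `ε`, since
  -- `(parity S xor ε) xor parity S` equals `ε`.
  member : Bool → Vec Bool N → Fin (suc N) → Bool
  member ε S zero    = parity S xor ε
  member ε S (suc x) = lookup S x

  edge : Bool → Vertex → Vertex → Bool
  edge ε (inj₁ i) (inj₁ j) = not (does (i ≟ j))
  edge ε (inj₁ i) (inj₂ S) = member ε S i
  edge ε (inj₂ S) (inj₁ i) = member ε S i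
  edge ε (inj₂ S) (inj₂ T) = false

  edge-sym : ∀ ε a b → edge ε a b ≡ edge ε b a
  edge-sym ε (inj₁ i) (inj₁ j) with i ≟ j
  ... | yes i≡j = cong not (≡.sym (dec-true (j ≟ i) (≡.sym i≡j)))
  ... | no  i≢j = cong not (≡.sym (dec-false (j ≟ i) (i≢j ∘ ≡.sym)))
  edge-sym ε (inj₁ i) (inj₂ S) = refl
  edge-sym ε (inj₂ S) (inj₁ i) = refl
  edge-sym ε (inj₂ S) (inj₂ T) = refl

  edge-irrefl : ∀ ε a → edge ε a a ≡ false
  edge-irrefl ε (inj₁ i) = cong not (dec-true (i ≟ i) refl)
  edge-irrefl ε (inj₂ S) = refl

  graph : Bool → Graph
  graph ε = record
    { n       = suc N + 2 ^ N
    ; nonZero = _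
    ; adj     = λ a b → edge ε (decode a) (decode b)
    ; sym     = λ a b → edge-sym ε (decode a) (decode b)
    ; irrefl  = λ a → edge-irrefl ε (decode a)
    }

  -- Toggling one clique vertex in every set.

  toggle : Fin N → Vertex → Vertex
  toggle y (inj₁ i) = inj₁ i
  toggle y (inj₂ S) = inj₂ (updateAt S y not)

  toggle-involutive : ∀ y a → toggle y (toggle y a) ≡ a
  toggle-involutive y (inj₁ i) = refl
  toggle-involutive y (inj₂ S) = cong inj₂
    (≡.trans (Vecₚ.updateAt-updateAt y S) (≡.trans (Vecₚ.updateAt-cong y not-involutive S) (Vecₚ.updateAt-id y S)))

  -- At `zero` both arguments of the xor are negated, which cancels. Hence toggling `y` in `S` while
  -- switching `ε` changes the full set at `suc y` only.
  member-toggle : ∀ ε y S i → i ≢ suc y → member (not ε) (updateAt S y not) i ≡ member ε S i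
  member-toggle ε y S zero    _  =
    ≡.trans (cong (_xor not ε) (parity-updateAt-not S y)) (xor-annihilates-not (parity S) ε)
  member-toggle ε y S (suc x) x≢ = lookup∘updateAt′ x y (x≢ ∘ cong suc) S

  -- The colour `just y` marks the clique vertex whose adjacencies to sets a toggle at `y` would
  -- alter. Vertex 0 keeps its adjacencies under every toggle with switched parity, so it has no
  -- colour.
  colour : Vertex → Maybe (Fin N)
  colour (inj₁ zero)    = nothing
  colour (inj₁ (suc x)) = just x
  colour (inj₂ S)       = nothing

  colour-toggle : ∀ y a → colour (toggle y a) ≡ colour a
  colour-toggle y (inj₁ i) = refl
  colour-toggle y (inj₂ S) = refl

  edge-toggle : ∀ ε y a b → colour a ≢ just y → colour b ≢ just y →
                edge (not ε) (toggle y a) (toggle y b) ≡ edge ε a b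
  edge-toggle ε y (inj₁ i) (inj₁ j) _  _  = refl
  edge-toggle ε y (inj₁ i) (inj₂ S) a≢ _  = member-toggle ε y S i λ { refl → a≢ refl }
  edge-toggle ε y (inj₂ S) (inj₁ i) _  b≢ = member-toggle ε y S i λ { refl → b≢ refl }
  edge-toggle ε y (inj₂ S) (inj₂ T) _  _  = refl

  flip : Fin N → Fin (suc N + 2 ^ N) → Fin (suc N + 2 ^ N)
  flip y = encode ∘ toggle y ∘ decode

  decode-flip : ∀ y a → decode (flip y a) ≡ toggle y (decode a)
  decode-flip y a = decode-encode _

  flip-involutive : ∀ y a → flip y (flip y a) ≡ a
  flip-involutive y a = ≡.trans
    (cong encode (≡.trans (cong (toggle y) (decode-flip y a)) (toggle-involutive y (decode a))))
    (encode-decode a)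

  flip-injective : ∀ y {a b} → flip y a ≡ flip y b → a ≡ b
  flip-injective y {a} {b} eq =
    ≡.trans (≡.sym (flip-involutive y a)) (≡.trans (cong (flip y) eq) (flip-involutive y b))

  module _ {m : ℕ} (m<N : m < N) where

    colours : Vec (Fin (suc N + 2 ^ N)) m → Vec (Maybe (Fin N)) m
    colours = Vec.map (colour ∘ decode)

    fresh : Vec (Fin (suc N + 2 ^ N)) m → Fin N
    fresh v = proj₁ (unused m<N (colours v))

    colour≢fresh : ∀ v u → colour (decode (lookup v u)) ≢ just (fresh v)
    colour≢fresh v u eq = proj₂ (unused m<N (colours v)) (u , ≡.trans (lookup-map u _ v) eq)

    twist : Vec (Fin (suc N + 2 ^ N)) m → Vec (Fin (suc N + 2 ^ N)) m
    twist v = Vec.map (flip (fresh v)) v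

    fresh-twist : ∀ v → fresh (twist v) ≡ fresh v
    fresh-twist v = cong (proj₁ ∘ unused m<N)
      (≡.trans (≡.sym (Vecₚ.map-∘ _ _ v))
        (Vecₚ.map-cong (λ a → ≡.trans (cong colour (decode-flip (fresh v) a)) (colour-toggle (fresh v) (decode a))) v))

    twist-involutive : ∀ v → twist (twist v) ≡ v
    twist-involutive v = begin
      Vec.map (flip (fresh (twist v))) (twist v)            ≡⟨ cong (λ y → Vec.map (flip y) (twist v)) (fresh-twist v) ⟩
      Vec.map (flip (fresh v)) (Vec.map (flip (fresh v)) v) ≡⟨ Vecₚ.map-∘ _ _ v ⟨
      Vec.map (flip (fresh v) ∘ flip (fresh v)) v           ≡⟨ Vecₚ.map-cong (flip-involutive (fresh v)) v ⟩
      Vec.map id v                                          ≡⟨ Vecₚ.map-id v ⟩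
      v                                                     ∎
      where open ≡-Reasoning

    twist-samePattern : ∀ ε v → SamePattern (graph ε) (graph (not ε)) (lookup v) (lookup (twist v))
    twist-samePattern ε v = record
      { adj-≡     = λ u w → ≡.sym (≡.trans (cong₂ (edge (not ε)) (decode-twist u) (decode-twist w))
          (edge-toggle ε y _ _ (colour≢fresh v u) (colour≢fresh v w)))
      ; reflect-≡ = λ u w eq → flip-injective y
          (≡.trans (≡.sym (lookup-map u (flip y) v)) (≡.trans eq (lookup-map w (flip y) v)))
      }
      where
      y = fresh v

      decode-twist : ∀ u → decode (lookup (twist v) u) ≡ toggle y (decode (lookup v u))
      decode-twist u = ≡.trans (cong decode (lookup-map u (flip y) v)) (decode-flip y (lookup v u))

  -- Both graphs live on the same `Fin` type, so `twist` acts on one common list of maps, where it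
  -- exchanges the maps counted for one graph with those counted for the other.
  count-graph : ∀ F → n F < N →
    (P : ∀ G → Map F G → Set) (P? : ∀ G f → Dec (P G f)) →
    (∀ {G G′ f f′} → SamePattern G G′ f f′ → P G f → P G′ f′) →
    count F (graph true) (P _) (P? _) ≡ count F (graph false) (P _) (P? _)
  count-graph F F<N P P? transfer = length-filter-involution
    (λ v → P? (graph true) (lookup v)) (λ v → P? (graph false) (lookup v))
    (allVecs-unique _ _) (allVecs-complete _)
    (twist F<N) (twist-involutive F<N)
    (λ v → transfer (twist-samePattern F<N true v))
    -- Since `not false` is `true`, the same construction also leads back.
    (λ v → transfer (twist-samePattern F<N false v))

  -- Isolated vertices in the two graphs.

  graph-true-noIsolatedVertex : 0 < N → NoIsolatedVertex (graph true)
  graph-true-noIsolatedVertex 0<N a =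
    let b , e = neighbour 0<N (decode a)
    in  encode b , ≡.trans (cong (edge true (decode a)) (decode-encode b)) e
    where
    neighbour : 0 < N → ∀ a → ∃ λ b → edge true a b ≡ true
    -- Here `0 < N` provides a second clique vertex.
    neighbour (s≤s _) (inj₁ zero)    = inj₁ (suc zero) , refl
    neighbour _       (inj₁ (suc x)) = inj₁ zero , refl
    -- An odd set is nonempty: it contains 0 if `S` is even, and otherwise `S` itself has an
    -- element.
    neighbour _       (inj₂ S) with parity S in p
    ... | false = inj₁ zero , cong (_xor true) p
    ... | true  with y , e ← parity-true⇒∃ S p = inj₁ (suc y) , e

  graph-false-isolatedVertex : ¬ NoIsolatedVertex (graph false)
  graph-false-isolatedVertex h =
    -- This `S` is empty, hence even, so with `ε` false 0 is left out as well and the vertex stands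
    -- for the empty set.
    let b , e = h (encode (inj₂ (replicate N false)))
    in  isolated (decode b) (subst (λ a → edge false a (decode b) ≡ true) (decode-encode (inj₂ (replicate N false))) e)
    where
    isolated : ∀ b → edge false (inj₂ (replicate N false)) b ≢ true
    isolated (inj₁ zero)    e rewrite parity-replicate-false N with () ← e
    isolated (inj₁ (suc x)) e rewrite lookup-replicate x false with () ← e

-- From equal counts to the absence of algorithms.

bound : ∀ {k} (Fs : Vec Graph k) → ∃ λ N → 0 < N × All (λ F → n F < N) Fs
-- Starting from 1 instead of 0 secures `0 < N`.
bound []       = 1 , s≤s z≤n , []
bound (F ∷ Fs) with N , 0<N , Fs<N ← bound Fs =
  suc (n F) ⊔ N , <-≤-trans 0<N (m≤n⊔m _ N) ,
  m≤m⊔n _ N ∷ All.map (λ lt → <-≤-trans lt (m≤n⊔m (suc (n F)) N)) Fs<N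

map-cong-All : ∀ {A B : Set} {P : A → Set} {f g : A → B} → (∀ {x} → P x → f x ≡ g x) →
  ∀ {k} {xs : Vec A k} → All P xs → Vec.map f xs ≡ Vec.map g xs
map-cong-All f≗g []         = refl
map-cong-All f≗g (px ∷ pxs) = cong₂ _∷_ (f≗g px) (map-cong-All f≗g pxs)

-- Once `N` exceeds the size of every queried graph, both graphs yield the same vector of counts, so
-- `X` cannot separate them, although only `graph N true` is in the class.
noAlgorithm : (cnt : Graph → Graph → ℕ) →
  (∀ N F → n F < N → cnt F (graph N true) ≡ cnt F (graph N false)) →
  ¬ HasAlgorithm cnt NoIsolatedVertex
noAlgorithm cnt agree (k , Fs , X , decides) with N , 0<N , Fs<N ← bound Fs =
  graph-false-isolatedVertex N (Equivalence.from (decides (graph N false))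
    (subst X (map-cong-All (λ {F} → agree N F) Fs<N)
      (Equivalence.to (decides (graph N true)) (graph-true-noIsolatedVertex N 0<N))))

theorem6p1 : ¬ HasQueryAlgorithm NoIsolatedVertex
theorem6p1 (inj₁ a) = noAlgorithm hom
  (λ N F F<N → count-graph N F F<N (IsHom F) (isHom? F) (isHom-transfer {F})) a
theorem6p1 (inj₂ (inj₁ a)) = noAlgorithm emb
  (λ N F F<N → count-graph N F F<N
    (λ G f → IsHom F G f × IsInjective F G f) (λ G f → isHom? F G f ×-dec isInjective? F G f)
    λ s (h , i) → isHom-transfer {F} s h , isInjective-transfer {F} s i) a
theorem6p1 (inj₂ (inj₂ (inj₁ a))) = noAlgorithm shom
  (λ N F F<N → count-graph N F F<N (IsStrongHom F) (isStrongHom? F) (isStrongHom-transfer {F})) a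
theorem6p1 (inj₂ (inj₂ (inj₂ a))) = noAlgorithm semb
  (λ N F F<N → count-graph N F F<N
    (λ G f → IsStrongHom F G f × IsInjective F G f) (λ G f → isStrongHom? F G f ×-dec isInjective? F G f)
    λ s (h , i) → isStrongHom-transfer {F} s h , isInjective-transfer {F} s i) a
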